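{- Let $c_n$ be the number of separable permutations $\sigma=\sigma_1\cdots\sigma_n$ of length $n$ having exactly two indices $i$ with $|\sigma_i-\sigma_{i+1}|=1$ or $|\sigma_{i-1}-\sigma_i|=1$ (ignoring nonexistent entries). Then $c_0=c_1=0$, $c_2=2$, and $c_n=2c_{n-1}+c_{n-2}$ for $n\ge3$. Consequently $$\sum_{n\ge0}c_nt^n=\frac{2t^2}{1-2t-t^2}.$$
   Context: A permutation is separable if it avoids both patterns $2413$ and $3142$, i.e., it has no subsequence of four entries order-isomorphic to $2413$ or to $3142$. -}

module Defs where

open import Data.Nat using (ℕ; zero; suc; _<_; _∸_; ∣_-_∣)
open import Data.Fin using (Fin; toℕ) renaming (_<_ to _<ᶠ_)
open import Data.Vec using (Vec; lookup)
open import Data.List using (List; length; map; foldr; upTo)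
open import Data.List.Membership.Propositional using (_∈_)
open import Data.List.Relation.Unary.Unique.Propositional using (Unique)
open import Data.Integer using (ℤ; +_; -_) renaming (_*_ to _*ℤ_; _+_ to _+ℤ_)
open import Data.Product using (Σ; ∃; _×_; ∃-syntax)
open import Data.Sum using (_⊎_)
open import Relation.Nullary using (¬_)
open import Relation.Binary.PropositionalEquality using (_≡_)
open import Function.Bundles using (_⇔_)

-- A word of length n with letters in Fin n (values 0..n-1 instead of 1..n;
-- this shift does not affect pattern containment or differences of values).
Word : ℕ → Set
Word n = Vec (Fin n) n

-- It is a permutation iff it is injective (hence bijective, being Fin n → Fin n).
IsPerm : ∀ {n} → Word n → Set
IsPerm {n} σ = ∀ (i j : Fin n) → lookup σ i ≡ lookup σ j → i ≡ j

_⟨_⟩ : ∀ {n} → Word n → Fin n → ℕ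
σ ⟨ i ⟩ = toℕ (lookup σ i)

Contains2413 : ∀ {n} → Word n → Set
Contains2413 {n} σ = ∃[ i ] ∃[ j ] ∃[ k ] ∃[ l ]
  (i <ᶠ j × j <ᶠ k × k <ᶠ l ×
   σ ⟨ k ⟩ < σ ⟨ i ⟩ × σ ⟨ i ⟩ < σ ⟨ l ⟩ × σ ⟨ l ⟩ < σ ⟨ j ⟩)

Contains3142 : ∀ {n} → Word n → Set
Contains3142 {n} σ = ∃[ i ] ∃[ j ] ∃[ k ] ∃[ l ]
  (i <ᶠ j × j <ᶠ k × k <ᶠ l ×
   σ ⟨ j ⟩ < σ ⟨ l ⟩ × σ ⟨ l ⟩ < σ ⟨ i ⟩ × σ ⟨ i ⟩ < σ ⟨ k ⟩)

Separable : ∀ {n} → Word n → Set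
Separable σ = ¬ Contains2413 σ × ¬ Contains3142 σ

AdjIndex : ∀ {n} → Word n → Fin n → Set
AdjIndex {n} σ i = ∃[ j ] (∣ toℕ i - toℕ j ∣ ≡ 1 × ∣ σ ⟨ i ⟩ - σ ⟨ j ⟩ ∣ ≡ 1)

ExactlyTwoAdj : ∀ {n} → Word n → Set
ExactlyTwoAdj {n} σ = ∃[ a ] ∃[ b ]
  (a <ᶠ b × AdjIndex σ a × AdjIndex σ b ×
   (∀ i → AdjIndex σ i → i ≡ a ⊎ i ≡ b))

Counted : ∀ {n} → Word n → Set
Counted σ = IsPerm σ × Separable σ × ExactlyTwoAdj σ

IsCount : {A : Set} → (A → Set) → ℕ → Set
IsCount {A} P k = Σ (List A) λ L → Unique L × (∀ x → (x ∈ L) ⇔ P x) × length L ≡ k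

FPS : Set
FPS = ℕ → ℤ

_·ₛ_ : FPS → FPS → FPS
(f ·ₛ g) n = foldr _+ℤ_ (+ 0) (map (λ k → f k *ℤ g (n ∸ k)) (upTo (suc n)))

denom : FPS
denom 0 = + 1
denom 1 = - (+ 2)
denom 2 = - (+ 1)
denom (suc (suc (suc _))) = + 0

numer : FPS
numer 2 = + 2
numer _ = + 0

series : (ℕ → ℕ) → FPS
series c n = + (c n)

{-# OPTIONS --safe #-}
module Submission where

-- A separable word of length ≥ 2 is a direct or skew sum α ⊕ β or α ⊖ β. A bond (two
-- neighbouring positions carrying neighbouring values) of a summand is a bond of the
-- word, so every separable word of length ≥ 2 has a bond, and if it has only one, one
-- of α, β is a single corner letter. Exactly two adjacent indices means exactly one
-- bond. Hence, from length 3 on, a direct sum with exactly one bond is 1 ⊕ α, α ⊕ 1 or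
-- 1 ⊕ α ⊕ 1 for a unique skew sum α with exactly one bond. Complementation exchanges
-- the two types, so both satisfy s(n) = 2 s(n-1) + s(n-2).

open import Defs
open import Data.Nat using (ℕ; zero; suc; _+_; _*_; _∸_; _≤_; _<_; _>_; z≤n; s≤s; s≤s⁻¹; ∣_-_∣)
open import Data.Nat.Induction using (<-rec)
open import Data.Nat.Properties
open import Data.Nat.Tactic.RingSolver using (solve-∀)
open import Data.Integer using (ℤ; -_) renaming (+_ to pos; _*_ to _*ℤ_; _+_ to _+ℤ_)
import Data.Integer.Properties as ℤ
import Data.Integer.Solver as ℤSolver
open import Data.Fin using (Fin; zero; suc; toℕ; fromℕ; fromℕ<; opposite; punchOut)
import Data.Fin.Properties as Fin
open import Data.Vec using (Vec; []; _∷_; lookup; map; tabulate)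
open import Data.Vec.Properties using (lookup-map; lookup∘tabulate; tabulate∘lookup; tabulate-cong)
open import Data.List using ([]; _∷_; _++_; length; foldr; applyUpTo) renaming (map to mapᴸ)
open import Data.List.Properties using (length-map; length-++)
open import Data.List.Membership.Propositional.Properties using (∈-map⁺; ∈-map⁻; ++-∈⇔)
open import Data.List.Membership.Propositional.Properties.WithK using (unique∧set⇒bag)
open import Data.List.Relation.Binary.BagAndSetEquality using (∼bag⇒↭)
open import Data.List.Relation.Binary.Permutation.Propositional.Properties using (↭-length)
open import Data.List.Relation.Unary.All using ([])
open import Data.List.Relation.Unary.AllPairs using ([]; _∷_)
open import Data.List.Relation.Unary.Any using (here; there)
import Data.List.Relation.Unary.Unique.Propositional.Properties as Unique
open import Data.Empty using (⊥; ⊥-elim)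
open import Data.Product using (_×_; _,_; proj₁; proj₂; ∃-syntax)
open import Data.Sum as Sum using (_⊎_; inj₁; inj₂)
open import Function.Base using (_∘_; flip; case_of_)
open import Function.Bundles using (_⇔_; mk⇔; Equivalence)
open import Function.Properties.Equivalence using () renaming (sym to ⇔-sym; trans to ⇔-trans)
open import Level using (0ℓ)
open import Relation.Binary.Core using (Rel)
open import Relation.Binary.Definitions using (tri<; tri≈; tri>)
open import Relation.Binary.PropositionalEquality
open import Relation.Binary.Structures using (IsStrictTotalOrder)
import Relation.Binary.Construct.Flip.EqAndOrd as Flip
open import Relation.Nullary using (¬_; yes; no; contradiction)

-- Cuts of separable words

-- Words of length n are first handled as functions g : ℕ → ℕ looked at on [0, n),
-- so that a factor of a word is again a word, namely a shift of g.

InjectiveBelow : ℕ → (ℕ → ℕ) → Set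
InjectiveBelow n g = ∀ {i j} → i < j → j < n → g i ≢ g j

-- For R = _<_ the pattern is 3142, for R = _>_ it is 2413.
Avoids : Rel ℕ 0ℓ → ℕ → (ℕ → ℕ) → Set
Avoids R n g = ∀ {i j k l} → i < j → j < k → k < l → l < n →
  R (g j) (g l) → R (g l) (g i) → R (g i) (g k) → ⊥

Cut : Rel ℕ 0ℓ → ℕ → (ℕ → ℕ) → ℕ → Set
Cut R n g k = ∀ {i j} → i < k → k ≤ j → j < n → R (g i) (g j)

Decomposable : Rel ℕ 0ℓ → ℕ → (ℕ → ℕ) → Set
Decomposable R n g = ∃[ k ] (0 < k × k < n × Cut R n g k)

module _ {R : Rel ℕ 0ℓ} (O : IsStrictTotalOrder _≡_ R) where
  private module O = IsStrictTotalOrder O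

  -- The number `m` is the length of the longest run below `x` at the start of the first `k`
  -- entries. A positive `m` becomes the new cut when `x` is appended.
  prefixBelow : ∀ (g : ℕ → ℕ) x k → (∀ i → i < k → g i ≢ x) →
    ∃[ m ] (m ≤ k × (∀ i → i < m → R (g i) x) × (m ≡ k ⊎ (m < k × R x (g m))))
  prefixBelow g x zero    _  = 0 , z≤n , (λ _ ()) , inj₁ refl
  prefixBelow g x (suc k) ≢x with prefixBelow g x k (λ i i<k → ≢x i (m<n⇒m<1+n i<k))
  ... | m , m≤k , below , inj₂ (m<k , x<gm) =
    m , m≤n⇒m≤1+n m≤k , below , inj₂ (m<n⇒m<1+n m<k , x<gm)
  ... | .k , _ , below , inj₁ refl with O.compare (g k) x
  ...   | tri≈ _ gk≡x _ = contradiction gk≡x (≢x k ≤-refl)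
  ...   | tri> _ _ x<gk = k , n≤1+n k , below , inj₂ (≤-refl , x<gk)
  ...   | tri< gk<x _ _ = suc k , ≤-refl , below′ , inj₁ refl
    where
    below′ : ∀ i → i < suc k → R (g i) x
    below′ i i<1+k with m<1+n⇒m<n∨m≡n i<1+k
    ... | inj₁ i<k  = below i i<k
    ... | inj₂ refl = gk<x

  -- Let x = g n be the appended entry and k a cut of the first n entries. Avoiding
  -- the pattern forces the entries of [0, k) below x to precede those above x, so
  -- they form the first block of a cut; if there are none, x is below everything.
  decomposable-snoc : ∀ n g → InjectiveBelow (suc n) g → Avoids R (suc n) g →
    Decomposable R n g → Decomposable R (suc n) g ⊎ Decomposable (flip R) (suc n) g
  decomposable-snoc n g inj av (k , 0<k , k<n , cut)
    with prefixBelow g (g n) k (λ i i<k → inj (<-trans i<k k<n) ≤-refl)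
  ... | zero , _ , _ , inj₁ refl = contradiction 0<k λ ()
  ... | zero , _ , _ , inj₂ (_ , x<g0) = inj₂ (n , <-trans 0<k k<n , ≤-refl , cut′)
    where
    x<gi : ∀ i → i < n → R (g n) (g i)
    x<gi i i<n with ≤-total k i
    ... | inj₁ k≤i = O.trans x<g0 (cut 0<k k≤i i<n)
    ... | inj₂ i≤k with O.compare (g i) (g n)
    ...   | tri> _ _ x<gi = x<gi
    ...   | tri≈ _ eq _   = contradiction eq (inj i<n ≤-refl)
    ...   | tri< gi<x _ _ with m≤n⇒m<n∨m≡n i≤k | m≤n⇒m<n∨m≡n (z≤n {i})
    ...     | _         | inj₂ refl = x<g0
    ...     | inj₂ refl | _         = O.trans x<g0 (cut 0<k ≤-refl k<n)
    ...     | inj₁ i<k  | inj₁ 0<i  =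
      -- The forbidden pattern sits at positions `0`, `i`, `k`, `n`: the old cut puts the entry at
      -- `k` above the one at `0`.
      ⊥-elim (av 0<i i<k k<n ≤-refl gi<x x<g0 (cut 0<k ≤-refl k<n))
    cut′ : Cut (flip R) (suc n) g n
    cut′ {i} i<n n≤j j<1+n rewrite ≤-antisym (s≤s⁻¹ j<1+n) n≤j = x<gi i i<n
  ... | m@(suc _) , m≤k , below , end = inj₁ (m , s≤s z≤n , m<n⇒m<1+n (≤-<-trans m≤k k<n) , cut′)
    where
    x<gj : ∀ {j} → m ≤ j → j < k → R (g n) (g j)
    x<gj {j} m≤j j<k = Sum.[ (λ { refl → contradiction j<k (≤⇒≯ m≤j) }) , above ] end
      where
      above : m < k × R (g n) (g m) → R (g n) (g j)
      above (m<k , x<gm) with m≤n⇒m<n∨m≡n m≤j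
      ... | inj₂ refl = x<gm
      ... | inj₁ m<j with O.compare (g j) (g n)
      ...   | tri> _ _ x<gj = x<gj
      ...   | tri≈ _ eq _   = contradiction eq (inj (<-trans j<k k<n) ≤-refl)
      ...   | tri< gj<x _ _ =
        ⊥-elim (av m<j j<k k<n ≤-refl gj<x x<gm (cut m<k ≤-refl k<n))
    cut′ : Cut R (suc n) g m
    cut′ {i} {j} i<m m≤j j<1+n with m<1+n⇒m<n∨m≡n j<1+n
    ... | inj₂ refl = below i i<m
    ... | inj₁ j<n with ≤-<-connex k j
    ...   | inj₁ k≤j = cut (<-≤-trans i<m m≤k) k≤j j<n
    ...   | inj₂ j<k = O.trans (below i i<m) (x<gj m≤j j<k)

>-isStrictTotalOrder : IsStrictTotalOrder _≡_ _>_
>-isStrictTotalOrder = Flip.isStrictTotalOrder <-isStrictTotalOrder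

decomposable-pair : ∀ {R : Rel ℕ 0ℓ} {g} → R (g 0) (g 1) → Decomposable R 2 g
decomposable-pair {R} {g} r = 1 , s≤s z≤n , ≤-refl , cut
  where
  cut : Cut R 2 g 1
  cut {zero}  {suc zero}    _ _ _ = r
  cut {zero}  {suc (suc _)} _ _ (s≤s (s≤s ()))
  cut {suc _} (s≤s ())

-- Induction on the length, appending the last entry to a shorter decomposable word. An old direct
-- cut needs only the avoidance of 3142, an old skew cut only that of 2413.
separable⇒decomposable : ∀ n g → InjectiveBelow (2 + n) g →
  Avoids _<_ (2 + n) g → Avoids _>_ (2 + n) g →
  Decomposable _<_ (2 + n) g ⊎ Decomposable _>_ (2 + n) g
separable⇒decomposable zero g inj _ _ with <-cmp (g 0) (g 1)
... | tri< lt _ _ = inj₁ (decomposable-pair {_<_} lt)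
... | tri≈ _ eq _ = contradiction eq (inj (s≤s z≤n) ≤-refl)
... | tri> _ _ gt = inj₂ (decomposable-pair {_>_} gt)
separable⇒decomposable (suc n) g inj av< av>
  with separable⇒decomposable n g (λ i<j j<n → inj i<j (m<n⇒m<1+n j<n))
         (λ p q r l< → av< p q r (m<n⇒m<1+n l<)) (λ p q r l< → av> p q r (m<n⇒m<1+n l<))
... | inj₁ d = decomposable-snoc <-isStrictTotalOrder (2 + n) g inj av< d
-- For `_>_` the flipped relation is `_<_`, so the two outcomes arrive in the opposite order.
... | inj₂ d = Sum.swap (decomposable-snoc >-isStrictTotalOrder (2 + n) g inj av> d)

-- Bonds of separable words

Between : ℕ → ℕ → ℕ → Set
Between a x b = (a < x × x < b) ⊎ (b < x × x < a)

-- Unlike "values differing by 1", this property passes from a block of a cut to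
-- the whole word without knowing which values the block takes.
Bond : ℕ → (ℕ → ℕ) → ℕ → Set
Bond n g i = suc i < n × (∀ {j} → j < n → ¬ Between (g i) (g j) (g (suc i)))

AnyCut : ℕ → (ℕ → ℕ) → ℕ → Set
AnyCut n g k = Cut _<_ n g k ⊎ Cut _>_ n g k

-- The second block lies entirely on one side of both entries of the bond, so none of its entries
-- can separate them.
bond-left : ∀ {n g k i} → k < n → AnyCut n g k → Bond k g i → Bond n g i
bond-left {n} {g} {k} {i} k<n cut (1+i<k , empty) = <-trans 1+i<k k<n , empty′
  where
  i<k = <-trans (n<1+n i) 1+i<k
  empty′ : ∀ {j} → j < n → ¬ Between (g i) (g j) (g (suc i))
  empty′ {j} j<n with ≤-<-connex k j
  ... | inj₂ j<k = empty j<k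
  ... | inj₁ k≤j = Sum.[
      (λ c → Sum.[ (λ (_ , lt) → <-asym lt (c 1+i<k k≤j j<n))
                 , (λ (_ , lt) → <-asym lt (c i<k k≤j j<n)) ]) ,
      (λ c → Sum.[ (λ (lt , _) → <-asym lt (c i<k k≤j j<n))
                 , (λ (lt , _) → <-asym lt (c 1+i<k k≤j j<n)) ]) ] cut

bond-right : ∀ {n g k i} → AnyCut (k + n) g k → Bond n (g ∘ (k +_)) i → Bond (k + n) g (k + i)
bond-right {n} {g} {k} {i} cut (1+i<n , empty) = 1+k+i<k+n , empty′
  where
  1+k+i<k+n : suc (k + i) < k + n
  1+k+i<k+n = subst (_< k + n) (+-suc k i) (+-monoʳ-< k 1+i<n)
  k≤k+i = m≤m+n k i
  k+i<k+n = <-trans (n<1+n (k + i)) 1+k+i<k+n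
  empty′ : ∀ {j} → j < k + n → ¬ Between (g (k + i)) (g j) (g (suc (k + i)))
  empty′ {j} j<k+n with ≤-<-connex k j
  ... | inj₁ k≤j with j′ , refl ← m≤n⇒∃[o]m+o≡n k≤j =
    subst (λ z → ¬ Between (g (k + i)) (g j) (g z)) (+-suc k i) (empty (+-cancelˡ-< k j′ n j<k+n))
  ... | inj₂ j<k = Sum.[
      (λ c → Sum.[ (λ (lt , _) → <-asym lt (c j<k k≤k+i k+i<k+n))
                 , (λ (lt , _) → <-asym lt (c j<k (m≤n⇒m≤1+n k≤k+i) 1+k+i<k+n)) ]) ,
      (λ c → Sum.[ (λ (_ , lt) → <-asym lt (c j<k (m≤n⇒m≤1+n k≤k+i) 1+k+i<k+n))
                 , (λ (_ , lt) → <-asym lt (c j<k k≤k+i k+i<k+n)) ]) ] cut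

SeparableBelow : ℕ → (ℕ → ℕ) → Set
SeparableBelow n g = InjectiveBelow n g × Avoids _<_ n g × Avoids _>_ n g

separable-cut : ∀ n g → SeparableBelow (2 + n) g →
  ∃[ k ] (0 < k × k < 2 + n × AnyCut (2 + n) g k)
separable-cut n g (inj , av< , av>) with separable⇒decomposable n g inj av< av>
... | inj₁ (k , 0<k , k<n , c) = k , 0<k , k<n , inj₁ c
... | inj₂ (k , 0<k , k<n , c) = k , 0<k , k<n , inj₂ c

separable-take : ∀ {n g k} → k ≤ n → SeparableBelow n g → SeparableBelow k g
separable-take k≤n (inj , av< , av>) =
    (λ i<j j<k → inj i<j (<-≤-trans j<k k≤n))
  , (λ p q r l<k → av< p q r (<-≤-trans l<k k≤n))
  , (λ p q r l<k → av> p q r (<-≤-trans l<k k≤n))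

separable-drop : ∀ {n g} k → SeparableBelow (k + n) g → SeparableBelow n (g ∘ (k +_))
separable-drop k (inj , av< , av>) =
    (λ i<j j<n → inj (sh i<j) (sh j<n))
  , (λ p q r l<n → av< (sh p) (sh q) (sh r) (sh l<n))
  , (λ p q r l<n → av> (sh p) (sh q) (sh r) (sh l<n))
  where
  sh : ∀ {i j} → i < j → k + i < k + j
  sh = +-monoʳ-< k

-- Strong induction through a cut. The first block is used if it has at least two letters; otherwise
-- it is a single letter and the rest is used. In length two no entry is left to lie between.
separable-bond : ∀ n g → SeparableBelow (2 + n) g → ∃[ i ] Bond (2 + n) g i
separable-bond = <-rec _ step
  where
  step : ∀ n → (∀ {m} → m < n → ∀ g → SeparableBelow (2 + m) g → ∃[ i ] Bond (2 + m) g i) →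
         ∀ g → SeparableBelow (2 + n) g → ∃[ i ] Bond (2 + n) g i
  step zero rec g sep = 0 , ≤-refl , λ
    { {zero} _ → Sum.[ (λ (lt , _) → <-irrefl refl lt) , (λ (_ , lt) → <-irrefl refl lt) ]
    ; {suc zero} _ → Sum.[ (λ (_ , lt) → <-irrefl refl lt) , (λ (lt , _) → <-irrefl refl lt) ]
    ; {suc (suc _)} (s≤s (s≤s ())) }
  step (suc n) rec g sep with separable-cut (suc n) g sep
  ... | suc zero , _ , _ , cut =
    let i , b = rec ≤-refl (g ∘ (1 +_)) (separable-drop 1 sep) in 1 + i , bond-right cut b
  ... | suc (suc k) , _ , k<n , cut =
    let i , b = rec (s≤s⁻¹ (s≤s⁻¹ k<n)) g (separable-take (<⇒≤ k<n) sep) in i , bond-left k<n cut b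

-- Both blocks of a cut contain a bond unless they are singletons.
cut-or-bonds : ∀ n g → SeparableBelow (2 + n) g →
  (∃[ i ] ∃[ j ] (suc i < j × Bond (2 + n) g i × Bond (2 + n) g j)) ⊎
  AnyCut (2 + n) g 1 ⊎ AnyCut (2 + n) g (suc n)
cut-or-bonds n g sep with separable-cut n g sep
... | suc zero , _ , _ , cut = inj₂ (inj₁ cut)
... | suc (suc k) , _ , k<n , cut with m≤n⇒∃[o]m+o≡n k<n
-- The difference counts the letters of the second block beyond its first one: at zero that block is
-- the last letter alone, otherwise both blocks are long enough for a bond.
...   | zero , refl rewrite +-identityʳ k = inj₂ (inj₂ cut)
...   | suc m , eq = inj₁ (two-bonds eq)
  where
  two-bonds : 3 + k + suc m ≡ 2 + n →
    ∃[ i ] ∃[ j ] (suc i < j × Bond (2 + n) g i × Bond (2 + n) g j)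
  two-bonds eq with refl ← trans (sym eq) (sym (+-suc (2 + k) (suc m))) =
    let i , b  = separable-bond k g (separable-take (<⇒≤ k<n) sep)
        j , b′ = separable-bond m (g ∘ (2 + k +_)) (separable-drop (2 + k) sep)
    in i , 2 + k + j , <-≤-trans (proj₁ b) (m≤m+n (2 + k) j) ,
       bond-left k<n cut b , bond-right cut b′

-- Bonds and adjacent indices of a permutation

-- The length `m` is separate from the alphabet size `n` so that the recursion can pass to the tail.
-- The default `0` past the end is harmless, as the predicates above inspect only positions below
-- the length.
at : ∀ {n m} → Vec (Fin n) m → ℕ → ℕ
at []       _       = 0
at (x ∷ xs) zero    = toℕ x
at (x ∷ xs) (suc i) = at xs i

at-toℕ : ∀ {n m} (xs : Vec (Fin n) m) i → at xs (toℕ i) ≡ toℕ (lookup xs i)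
at-toℕ (x ∷ xs) zero    = refl
at-toℕ (x ∷ xs) (suc i) = at-toℕ xs i

toℕ-surjective : ∀ {i n} → i < n → ∃[ k ] toℕ {n} k ≡ i
toℕ-surjective i<n = fromℕ< i<n , Fin.toℕ-fromℕ< i<n

at-separable : ∀ {n} {σ : Word n} → IsPerm σ → Separable σ → SeparableBelow n (at σ)
at-separable {n} {σ} perm (¬2413 , ¬3142) = inj , av< , av>
  where
  R-at : ∀ {i j} → at σ (toℕ i) < at σ (toℕ j) → σ ⟨ i ⟩ < σ ⟨ j ⟩
  R-at {i} {j} = subst₂ _<_ (at-toℕ σ i) (at-toℕ σ j)
  inj : InjectiveBelow n (at σ)
  inj i<j j<n eq with i , refl ← toℕ-surjective (<-trans i<j j<n) | j , refl ← toℕ-surjective j<n =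
    <⇒≢ i<j (cong toℕ (perm i j (Fin.toℕ-injective (trans (sym (at-toℕ σ i)) (trans eq (at-toℕ σ j))))))
  av< : Avoids _<_ n (at σ)
  av< p q r l<n a b c
    with l , refl ← toℕ-surjective l<n | k , refl ← toℕ-surjective (<-trans r l<n)
       | j , refl ← toℕ-surjective (<-trans q (<-trans r l<n))
       | i , refl ← toℕ-surjective (<-trans p (<-trans q (<-trans r l<n))) =
    ¬3142 (i , j , k , l , p , q , r , R-at a , R-at b , R-at c)
  av> : Avoids _>_ n (at σ)
  av> p q r l<n a b c
    with l , refl ← toℕ-surjective l<n | k , refl ← toℕ-surjective (<-trans r l<n)
       | j , refl ← toℕ-surjective (<-trans q (<-trans r l<n))
       | i , refl ← toℕ-surjective (<-trans p (<-trans q (<-trans r l<n))) =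
    -- The chain for `_>_` descends, so reading it from its small end reverses the three
    -- inequalities.
    ¬2413 (i , j , k , l , p , q , r , R-at c , R-at b , R-at a)

-- Pigeonhole: a missed value could be punched out of the codomain, leaving an injection from
-- `Fin (suc n)` to `Fin n`.
perm-surjective : ∀ {n} {σ : Word n} → IsPerm σ → ∀ v → ∃[ i ] lookup σ i ≡ v
perm-surjective {suc n} {σ} perm v with Fin.any? (λ i → lookup σ i Fin.≟ v)
... | yes hit = hit
... | no  miss = contradiction
  (Fin.injective⇒≤ {f = λ i → punchOut {i = v} (λ eq → miss (i , sym eq))}
    (λ eq → perm _ _ (Fin.punchOut-injective {i = v} _ _ eq)))
  1+n≰n

∣n-1+n∣≡1 : ∀ n → ∣ n - suc n ∣ ≡ 1
∣n-1+n∣≡1 zero    = refl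
∣n-1+n∣≡1 (suc n) = ∣n-1+n∣≡1 n

-- In a permutation every intermediate value occurs.
perm-consecutive : ∀ {n} {σ : Word n} → IsPerm σ → ∀ {a b} → σ ⟨ a ⟩ < σ ⟨ b ⟩ →
  (∀ c → ¬ (σ ⟨ a ⟩ < σ ⟨ c ⟩ × σ ⟨ c ⟩ < σ ⟨ b ⟩)) → ∣ σ ⟨ a ⟩ - σ ⟨ b ⟩ ∣ ≡ 1
perm-consecutive {n} {σ} perm {a} {b} lt empty with m≤n⇒m<n∨m≡n lt
... | inj₂ eq rewrite sym eq = ∣n-1+n∣≡1 (σ ⟨ a ⟩)
... | inj₁ gap with v , eq ← toℕ-surjective (<-trans gap (Fin.toℕ<n (lookup σ b)))
    with c , refl ← perm-surjective {σ = σ} perm v =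
  ⊥-elim (empty c (≤-reflexive (sym eq) , subst (_< σ ⟨ b ⟩) (sym eq) gap))

perm-adjacent : ∀ {n} {σ : Word n} → IsPerm σ → ∀ {a b} → a ≢ b →
  (∀ c → ¬ Between (σ ⟨ a ⟩) (σ ⟨ c ⟩) (σ ⟨ b ⟩)) → ∣ σ ⟨ a ⟩ - σ ⟨ b ⟩ ∣ ≡ 1
perm-adjacent {n} {σ} perm {a} {b} a≢b empty with <-cmp (σ ⟨ a ⟩) (σ ⟨ b ⟩)
... | tri≈ _ eq _ = contradiction (perm a b (Fin.toℕ-injective eq)) a≢b
... | tri< lt _ _ = perm-consecutive {σ = σ} perm lt (λ c → empty c ∘ inj₁)
... | tri> _ _ gt = trans (∣-∣-comm (σ ⟨ a ⟩) _) (perm-consecutive {σ = σ} perm gt (λ c → empty c ∘ inj₂))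

-- Here the order-theoretic notion meets the numerical one: in a permutation all values occur, so
-- entries with nothing between them differ by exactly 1.
bond-adjacent : ∀ {n} {σ : Word n} → IsPerm σ → ∀ {i} → Bond n (at σ) i →
  ∃[ a ] ∃[ b ] (toℕ a ≡ i × toℕ b ≡ suc i × AdjIndex σ a × AdjIndex σ b)
bond-adjacent {n} {σ} perm (1+i<n , empty)
  with b , eqb ← toℕ-surjective 1+i<n | a , refl ← toℕ-surjective (<-trans (n<1+n _) 1+i<n) =
  a , b , refl , eqb , (b , dist , vals) ,
  (a , trans (∣-∣-comm (toℕ b) _) dist , trans (∣-∣-comm (σ ⟨ b ⟩) _) vals)
  where
  dist : ∣ toℕ a - toℕ b ∣ ≡ 1
  dist rewrite eqb = ∣n-1+n∣≡1 (toℕ a)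
  empty′ : ∀ c → ¬ Between (σ ⟨ a ⟩) (σ ⟨ c ⟩) (σ ⟨ b ⟩)
  empty′ c bt with e ← empty (Fin.toℕ<n c)
    rewrite sym eqb | at-toℕ σ a | at-toℕ σ b | at-toℕ σ c = e bt
  vals : ∣ σ ⟨ a ⟩ - σ ⟨ b ⟩ ∣ ≡ 1
  vals = perm-adjacent {σ = σ} perm (λ { refl → 1+n≢n (sym eqb) }) empty′

-- Two distinct adjacent indices must be the two given witnesses in some order, so any such pair may
-- replace them.
twoAdj-cover : ∀ {n} {σ : Word n} → ExactlyTwoAdj σ → ∀ {a b} → a ≢ b →
  AdjIndex σ a → AdjIndex σ b → ∀ {i} → AdjIndex σ i → i ≡ a ⊎ i ≡ b
twoAdj-cover (_ , _ , _ , _ , _ , cover) {a} {b} a≢b adja adjb {i} adji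
  with cover a adja | cover b adjb | cover i adji
... | inj₁ refl | inj₁ refl | _      = contradiction refl a≢b
... | inj₂ refl | inj₂ refl | _      = contradiction refl a≢b
... | inj₁ refl | inj₂ refl | i∈     = i∈
... | inj₂ refl | inj₁ refl | i∈     = Sum.swap i∈

-- Corner letters, complement and reversal

First0 LastMax SumCorner : ∀ {n} → Word (suc n) → Set
First0 σ = lookup σ zero ≡ zero
LastMax {n} σ = lookup σ (fromℕ n) ≡ fromℕ n
SumCorner σ = First0 σ ⊎ LastMax σ

opaque
  -- Kept opaque, so that all later arguments go through the two lookup laws.
  comp rev : ∀ {n} → Word n → Word n
  comp σ = map opposite σ
  rev σ = tabulate (lookup σ ∘ opposite)

  lookup-comp : ∀ {n} (σ : Word n) i → lookup (comp σ) i ≡ opposite (lookup σ i)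
  lookup-comp σ i = lookup-map i opposite σ

  lookup-rev : ∀ {n} (σ : Word n) i → lookup (rev σ) i ≡ lookup σ (opposite i)
  lookup-rev σ i = lookup∘tabulate _ i

-- The half turn of the diagram: it preserves direct sums and exchanges the bottom left corner with
-- the top right one.
rc : ∀ {n} → Word n → Word n
rc = comp ∘ rev

lookup-rc : ∀ {n} (σ : Word n) i → lookup (rc σ) i ≡ opposite (lookup σ (opposite i))
lookup-rc σ i = trans (lookup-comp (rev σ) i) (cong opposite (lookup-rev σ i))

lookup-injective : ∀ {A : Set} {n} {xs ys : Vec A n} → (∀ i → lookup xs i ≡ lookup ys i) → xs ≡ ys
lookup-injective {xs = xs} {ys} eq =
  trans (sym (tabulate∘lookup xs)) (trans (tabulate-cong eq) (tabulate∘lookup ys))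

comp-involutive : ∀ {n} (σ : Word n) → comp (comp σ) ≡ σ
comp-involutive σ = lookup-injective λ i → trans (lookup-comp (comp σ) i)
  (trans (cong opposite (lookup-comp σ i)) (Fin.opposite-involutive _))

rc-involutive : ∀ {n} (σ : Word n) → rc (rc σ) ≡ σ
rc-involutive σ = lookup-injective λ i → trans (lookup-rc (rc σ) i)
  (trans (cong opposite (lookup-rc σ (opposite i)))
  (trans (Fin.opposite-involutive _) (cong (lookup σ) (Fin.opposite-involutive i))))

opposite-anti : ∀ {n} {i j : Fin n} → toℕ i < toℕ j → toℕ (opposite j) < toℕ (opposite i)
opposite-anti {n} {i} {j} i<j rewrite Fin.opposite-prop i | Fin.opposite-prop j =
  ∸-monoʳ-< (s≤s i<j) (Fin.toℕ<n j)

opposite-anti⁻ : ∀ {n} {i j : Fin n} → toℕ (opposite j) < toℕ (opposite i) → toℕ i < toℕ j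
opposite-anti⁻ {i = i} {j} lt =
  subst₂ (λ a b → toℕ a < toℕ b) (Fin.opposite-involutive i) (Fin.opposite-involutive j) (opposite-anti lt)

[n∸a]∸[n∸b] : ∀ n a {b} → b ≤ n → (n ∸ a) ∸ (n ∸ b) ≡ b ∸ a
[n∸a]∸[n∸b] n a {b} b≤n = begin
  n ∸ a ∸ (n ∸ b)   ≡⟨ ∸-+-assoc n a (n ∸ b) ⟩
  n ∸ (a + (n ∸ b)) ≡⟨ cong (n ∸_) (+-comm a (n ∸ b)) ⟩
  n ∸ (n ∸ b + a)   ≡⟨ ∸-+-assoc n (n ∸ b) a ⟨
  n ∸ (n ∸ b) ∸ a   ≡⟨ cong (_∸ a) (m∸[m∸n]≡n b≤n) ⟩
  b ∸ a             ∎
  where open ≡-Reasoning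

∣∸-∸∣ : ∀ n {a b} → a ≤ n → b ≤ n → ∣ n ∸ a - n ∸ b ∣ ≡ ∣ a - b ∣
∣∸-∸∣ n {a} {b} a≤n b≤n with ≤-total a b
... | inj₁ a≤b rewrite m≤n⇒∣n-m∣≡n∸m (∸-monoʳ-≤ n a≤b) | m≤n⇒∣m-n∣≡n∸m a≤b = [n∸a]∸[n∸b] n a b≤n
... | inj₂ b≤a rewrite m≤n⇒∣m-n∣≡n∸m (∸-monoʳ-≤ n b≤a) | m≤n⇒∣n-m∣≡n∸m b≤a = [n∸a]∸[n∸b] n b a≤n

opposite-dist : ∀ {n} (i j : Fin n) → ∣ toℕ (opposite i) - toℕ (opposite j) ∣ ≡ ∣ toℕ i - toℕ j ∣
opposite-dist {n} i j rewrite Fin.opposite-prop i | Fin.opposite-prop j =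
  ∣∸-∸∣ n (Fin.toℕ<n i) (Fin.toℕ<n j)

opposite-injective : ∀ {n} {i j : Fin n} → opposite i ≡ opposite j → i ≡ j
opposite-injective {i = i} {j} eq =
  trans (sym (Fin.opposite-involutive i)) (trans (cong opposite eq) (Fin.opposite-involutive j))

-- Reversing all inequalities of values exchanges 2413 and 3142, with the chain read backwards.
-- Distances between values are unchanged, so the adjacent indices stay where they are.
comp-counted : ∀ {n} {σ : Word n} → Counted σ → Counted (comp σ)
comp-counted {n} {σ} (perm , (¬2413 , ¬3142) , a , b , a<b , adja , adjb , cover) =
  (λ i j eq → perm i j (opposite-injective (subst₂ _≡_ (lookup-comp σ i) (lookup-comp σ j) eq))) ,
  ( (λ (i , j , k , l , p , q , r , x , y , z) → ¬3142 (i , j , k , l , p , q , r , anti z , anti y , anti x))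
  , (λ (i , j , k , l , p , q , r , x , y , z) → ¬2413 (i , j , k , l , p , q , r , anti z , anti y , anti x))) ,
  a , b , a<b , to adja , to adjb , λ i adji → cover i (from adji)
  where
  anti : ∀ {i j} → comp σ ⟨ i ⟩ < comp σ ⟨ j ⟩ → σ ⟨ j ⟩ < σ ⟨ i ⟩
  anti {i} {j} lt rewrite lookup-comp σ i | lookup-comp σ j = opposite-anti⁻ lt
  dist : ∀ i j → ∣ comp σ ⟨ i ⟩ - comp σ ⟨ j ⟩ ∣ ≡ ∣ σ ⟨ i ⟩ - σ ⟨ j ⟩ ∣
  dist i j rewrite lookup-comp σ i | lookup-comp σ j = opposite-dist (lookup σ i) (lookup σ j)
  to : ∀ {i} → AdjIndex σ i → AdjIndex (comp σ) i
  to {i} (j , d , e) = j , d , trans (dist i j) e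
  from : ∀ {i} → AdjIndex (comp σ) i → AdjIndex σ i
  from {i} (j , d , e) = j , d , trans (sym (dist i j)) e

-- Reading positions backwards also exchanges 2413 and 3142, now with the chain of values kept; the
-- two adjacent indices trade their order.
rev-counted : ∀ {n} {σ : Word n} → Counted σ → Counted (rev σ)
rev-counted {n} {σ} (perm , (¬2413 , ¬3142) , a , b , a<b , adja , adjb , cover) =
  (λ i j eq → opposite-injective (perm _ _ (subst₂ _≡_ (lookup-rev σ i) (lookup-rev σ j) eq))) ,
  ( (λ (i , j , k , l , p , q , r , x , y , z) → ¬3142
        (_ , _ , _ , _ , opposite-anti r , opposite-anti q , opposite-anti p , mono x , mono y , mono z))
  , (λ (i , j , k , l , p , q , r , x , y , z) → ¬2413
        (_ , _ , _ , _ , opposite-anti r , opposite-anti q , opposite-anti p , mono x , mono y , mono z))) ,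
  opposite b , opposite a , opposite-anti a<b , to adjb , to adja ,
  λ i adji → Sum.swap (Sum.map flip-eq flip-eq (cover (opposite i) (from adji)))
  where
  flip-eq : ∀ {i j : Fin n} → opposite i ≡ j → i ≡ opposite j
  flip-eq {i} eq = trans (sym (Fin.opposite-involutive i)) (cong opposite eq)
  mono : ∀ {i j} → rev σ ⟨ i ⟩ < rev σ ⟨ j ⟩ → σ ⟨ opposite i ⟩ < σ ⟨ opposite j ⟩
  mono {i} {j} = subst₂ (λ x y → toℕ x < toℕ y) (lookup-rev σ i) (lookup-rev σ j)
  dist : ∀ i j → ∣ rev σ ⟨ i ⟩ - rev σ ⟨ j ⟩ ∣ ≡ ∣ σ ⟨ opposite i ⟩ - σ ⟨ opposite j ⟩ ∣
  dist i j rewrite lookup-rev σ i | lookup-rev σ j = refl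
  from : ∀ {i} → AdjIndex (rev σ) i → AdjIndex σ (opposite i)
  from {i} (j , d , e) = opposite j , trans (opposite-dist i j) d , trans (sym (dist i j)) e
  to : ∀ {i} → AdjIndex σ i → AdjIndex (rev σ) (opposite i)
  to {i} (j , d , e) = opposite j , trans (opposite-dist i j) d ,
    trans (dist (opposite i) (opposite j))
      (subst₂ (λ x y → ∣ σ ⟨ x ⟩ - σ ⟨ y ⟩ ∣ ≡ 1)
        (sym (Fin.opposite-involutive i)) (sym (Fin.opposite-involutive j)) e)

rc-counted : ∀ {n} {σ : Word n} → Counted σ → Counted (rc σ)
rc-counted {σ = σ} = comp-counted {σ = rev σ} ∘ rev-counted {σ = σ}

-- Every counted permutation has a corner letter

opposite-fromℕ : ∀ n → opposite (fromℕ n) ≡ zero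
opposite-fromℕ n = Fin.opposite-involutive {suc n} zero

-- Surjectivity yields a position of the value zero; at any other position than `a` it would exceed
-- a smaller value.
minimal⇒zero : ∀ {n} {σ : Word (suc n)} → IsPerm σ → ∀ a →
  (∀ j → j ≢ a → σ ⟨ a ⟩ < σ ⟨ j ⟩) → lookup σ a ≡ zero
minimal⇒zero {σ = σ} perm a least with perm-surjective {σ = σ} perm zero
... | j , eq with j Fin.≟ a
...   | yes refl = eq
...   | no j≢a   = contradiction (subst (λ v → σ ⟨ a ⟩ < toℕ v) eq (least j j≢a)) λ ()

maximal⇒fromℕ : ∀ {n} {σ : Word (suc n)} → IsPerm σ → ∀ a →
  (∀ j → j ≢ a → σ ⟨ j ⟩ < σ ⟨ a ⟩) → lookup σ a ≡ fromℕ n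
maximal⇒fromℕ {n} {σ} perm a greatest with perm-surjective {σ = σ} perm (fromℕ n)
... | j , eq with j Fin.≟ a
...   | yes refl = eq
...   | no j≢a   = contradiction
  (subst (_≤ n) (cong suc (trans (cong toℕ eq) (Fin.toℕ-fromℕ n)))
    (≤-trans (greatest j j≢a) (s≤s⁻¹ (Fin.toℕ<n (lookup σ a)))))
  1+n≰n

-- Two disjoint bonds would produce a third adjacent index. So some cut splits off a single end
-- letter, and its direction decides between `σ` and its complement.
counted-corner : ∀ {n} {σ : Word (suc n)} → Counted σ → SumCorner σ ⊎ SumCorner (comp σ)
counted-corner {zero} (_ , _ , zero , zero , () , _)
counted-corner {suc n} {σ} (perm , sep , two) with cut-or-bonds n (at σ) (at-separable {σ = σ} perm sep)
... | inj₁ (i , j , 1+i<j , b , b′)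
    with a₁ , a₂ , refl , eq₂ , adj₁ , adj₂ ← bond-adjacent {σ = σ} perm b
       | a₃ , _ , refl , _ , adj₃ , _ ← bond-adjacent {σ = σ} perm b′ =
  ⊥-elim (Sum.[ (λ { refl → 1+n≰n (<-trans (n<1+n _) 1+i<j) }) , (λ { refl → <-irrefl (sym eq₂) 1+i<j }) ]
    (twoAdj-cover {σ = σ} two (λ { refl → 1+n≢n (sym eq₂) }) adj₁ adj₂ adj₃))
... | inj₂ (inj₁ (inj₁ c)) = inj₁ (inj₁ (minimal⇒zero {σ = σ} perm zero least))
  where
  least : ∀ j → j ≢ zero → σ ⟨ zero ⟩ < σ ⟨ j ⟩
  least zero    j≢0 = contradiction refl j≢0
  least (suc j) _   = subst₂ _<_ (at-toℕ σ zero) (at-toℕ σ (suc j)) (c (s≤s z≤n) (s≤s z≤n) (Fin.toℕ<n (suc j)))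
... | inj₂ (inj₁ (inj₂ c)) = inj₂ (inj₁ (trans (lookup-comp σ zero)
    (trans (cong opposite (maximal⇒fromℕ {σ = σ} perm zero greatest)) (opposite-fromℕ (suc n)))))
  where
  greatest : ∀ j → j ≢ zero → σ ⟨ j ⟩ < σ ⟨ zero ⟩
  greatest zero    j≢0 = contradiction refl j≢0
  greatest (suc j) _   = subst₂ _<_ (at-toℕ σ (suc j)) (at-toℕ σ zero) (c (s≤s z≤n) (s≤s z≤n) (Fin.toℕ<n (suc j)))
... | inj₂ (inj₂ cut) = last-corner cut
  where
  last = fromℕ (suc n)
  below-last : ∀ j → j ≢ last → toℕ j < suc n
  below-last j j≢last = ≤∧≢⇒< (s≤s⁻¹ (Fin.toℕ<n j)) λ eq →
    j≢last (Fin.toℕ-injective (trans eq (sym (Fin.toℕ-fromℕ (suc n)))))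
  at-last : at σ (suc n) ≡ σ ⟨ last ⟩
  at-last = trans (cong (at σ) (sym (Fin.toℕ-fromℕ (suc n)))) (at-toℕ σ last)
  last-corner : AnyCut (2 + n) (at σ) (suc n) → SumCorner σ ⊎ SumCorner (comp σ)
  last-corner (inj₁ c) = inj₁ (inj₂ (maximal⇒fromℕ {σ = σ} perm last λ j j≢last →
    subst₂ _<_ (at-toℕ σ j) at-last (c (below-last j j≢last) ≤-refl ≤-refl)))
  last-corner (inj₂ c) = inj₂ (inj₂ (trans (lookup-comp σ last) (cong opposite
    (minimal⇒zero {σ = σ} perm last λ j j≢last →
      subst₂ _<_ at-last (at-toℕ σ j) (c (below-last j j≢last) ≤-refl ≤-refl)))))

-- Corners of both kinds would give one position two values or one value two positions. In length
-- one all corners coincide, but there `Counted` is empty.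
corners-exclusive : ∀ {n} {σ : Word (suc n)} → Counted σ → SumCorner σ → ¬ SumCorner (comp σ)
corners-exclusive {zero}  (_ , _ , zero , zero , () , _)
corners-exclusive {suc n} {σ} (perm , _) corner corner′ = excl corner (Sum.map first last corner′)
  where
  first : First0 (comp σ) → lookup σ zero ≡ fromℕ (suc n)
  first eq = opposite-injective (trans (sym (lookup-comp σ zero)) (trans eq (sym (opposite-fromℕ (suc n)))))
  last : LastMax (comp σ) → lookup σ (fromℕ (suc n)) ≡ zero
  last eq = opposite-injective (trans (sym (lookup-comp σ (fromℕ (suc n)))) eq)
  excl : SumCorner σ → lookup σ zero ≡ fromℕ (suc n) ⊎ lookup σ (fromℕ (suc n)) ≡ zero → ⊥
  excl (inj₁ p) (inj₁ q) = case trans (sym p) q of λ ()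
  excl (inj₁ p) (inj₂ q) = case perm _ _ (trans p (sym q)) of λ ()
  excl (inj₂ p) (inj₁ q) = case perm _ _ (trans p (sym q)) of λ ()
  excl (inj₂ p) (inj₂ q) = case trans (sym p) q of λ ()

-- Adding and removing a corner letter

-- bl (bottom left) is 1 ⊕ β and tr (top right) is β ⊕ 1.
bl tr : ∀ {n} → Word n → Word (suc n)
bl β = zero ∷ map suc β
tr β = rc (bl (rc β))

lookup-bl : ∀ {n} (β : Word n) i → lookup (bl β) (suc i) ≡ suc (lookup β i)
lookup-bl β i = lookup-map i suc β

bl-injective : ∀ {n} {β γ : Word n} → bl β ≡ bl γ → β ≡ γ
bl-injective {β = β} {γ} eq = lookup-injective λ i → Fin.suc-injective
  (trans (sym (lookup-bl β i)) (trans (cong (λ σ → lookup σ (suc i)) eq) (lookup-bl γ i)))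

rc-injective : ∀ {n} {β γ : Word n} → rc β ≡ rc γ → β ≡ γ
rc-injective {β = β} {γ} eq = trans (sym (rc-involutive β)) (trans (cong rc eq) (rc-involutive γ))

tr-injective : ∀ {n} {β γ : Word n} → tr β ≡ tr γ → β ≡ γ
tr-injective = rc-injective ∘ bl-injective ∘ rc-injective

adj-bl : ∀ {n} {β : Word n} {i} → AdjIndex β i → AdjIndex (bl β) (suc i)
adj-bl {β = β} {i} (j , d , e) = suc j , d ,
  subst₂ (λ x y → ∣ toℕ x - toℕ y ∣ ≡ 1) (sym (lookup-bl β i)) (sym (lookup-bl β j)) e

-- The prepended letter is next to the first letter of `β` only, and their values are neighbours
-- only if that letter is the least.
adj-bl⁻ : ∀ {n} {β : Word (suc n)} → ¬ First0 β → ∀ {i} → AdjIndex (bl β) (suc i) → AdjIndex β i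
adj-bl⁻ {β = β} ¬f {i} (suc j , d , e) = j , d ,
  subst₂ (λ x y → ∣ toℕ x - toℕ y ∣ ≡ 1) (lookup-bl β i) (lookup-bl β j) e
adj-bl⁻ {β = β} ¬f {zero} (zero , d , e) = contradiction (Fin.toℕ-injective (suc-injective
  (trans (cong toℕ (sym (lookup-bl β zero))) (trans (sym (∣-∣-identityʳ _)) e)))) ¬f

first0⇒adj-bl : ∀ {n} {β : Word (suc n)} → First0 β → AdjIndex (bl β) zero
first0⇒adj-bl {β = β} f = suc zero , refl , cong toℕ (trans (lookup-bl β zero) (cong suc f))

adj-bl⇒first0 : ∀ {n} {β : Word (suc n)} → AdjIndex (bl β) zero → First0 β
adj-bl⇒first0 {β = β} (suc zero , _ , e) =
  Fin.toℕ-injective (suc-injective (trans (cong toℕ (sym (lookup-bl β zero))) e))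

bl-< : ∀ {n} {β : Word n} {i j} → β ⟨ i ⟩ < β ⟨ j ⟩ → bl β ⟨ suc i ⟩ < bl β ⟨ suc j ⟩
bl-< {β = β} {i} {j} lt = subst₂ (λ x y → toℕ x < toℕ y) (sym (lookup-bl β i)) (sym (lookup-bl β j)) (s≤s lt)

bl-<⁻ : ∀ {n} {β : Word n} {i j} → bl β ⟨ suc i ⟩ < bl β ⟨ suc j ⟩ → β ⟨ i ⟩ < β ⟨ j ⟩
bl-<⁻ {β = β} {i} {j} lt = s≤s⁻¹ (subst₂ (λ x y → toℕ x < toℕ y) (lookup-bl β i) (lookup-bl β j) lt)

bl-perm : ∀ {n} {β : Word n} → IsPerm β → IsPerm (bl β)
bl-perm perm zero zero eq = refl
bl-perm {β = β} perm zero (suc j) eq = case trans eq (lookup-bl β j) of λ ()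
bl-perm {β = β} perm (suc i) zero eq = case trans (sym eq) (lookup-bl β i) of λ ()
bl-perm {β = β} perm (suc i) (suc j) eq =
  cong suc (perm i j (Fin.suc-injective (subst₂ _≡_ (lookup-bl β i) (lookup-bl β j) eq)))

bl-perm⁻ : ∀ {n} {β : Word n} → IsPerm (bl β) → IsPerm β
bl-perm⁻ {β = β} perm i j eq = Fin.suc-injective (perm (suc i) (suc j)
  (subst₂ _≡_ (sym (lookup-bl β i)) (sym (lookup-bl β j)) (cong suc eq)))

-- The first entry of either pattern exceeds another entry, so it cannot be the prepended zero; an
-- occurrence therefore lies inside `β`.
bl-separable : ∀ {n} {β : Word n} → Separable β → Separable (bl β)
bl-separable {β = β} (¬2413 , ¬3142) = no2413 , no3142
  where
  lt : ∀ {i j} → bl β ⟨ suc i ⟩ < bl β ⟨ suc j ⟩ → β ⟨ i ⟩ < β ⟨ j ⟩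
  lt = bl-<⁻ {β = β}
  no2413 : ¬ Contains2413 (bl β)
  no2413 (suc i , suc j , suc k , suc l , s≤s p , s≤s q , s≤s r , x , y , z) =
    ¬2413 (i , j , k , l , p , q , r , lt x , lt y , lt z)
  no3142 : ¬ Contains3142 (bl β)
  no3142 (suc i , suc j , suc k , suc l , s≤s p , s≤s q , s≤s r , x , y , z) =
    ¬3142 (i , j , k , l , p , q , r , lt x , lt y , lt z)

bl-separable⁻ : ∀ {n} {β : Word n} → Separable (bl β) → Separable β
bl-separable⁻ {β = β} (¬2413 , ¬3142) =
  (λ (i , j , k , l , p , q , r , x , y , z) →
    ¬2413 (suc i , suc j , suc k , suc l , s≤s p , s≤s q , s≤s r , lt x , lt y , lt z)) ,
  (λ (i , j , k , l , p , q , r , x , y , z) →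
    ¬3142 (suc i , suc j , suc k , suc l , s≤s p , s≤s q , s≤s r , lt x , lt y , lt z))
  where
  lt : ∀ {i j} → β ⟨ i ⟩ < β ⟨ j ⟩ → bl β ⟨ suc i ⟩ < bl β ⟨ suc j ⟩
  lt = bl-< {β = β}

bl-counted : ∀ {n} {β : Word (suc n)} → Counted β → ¬ First0 β → Counted (bl β)
bl-counted {n} {β} (perm , sep , a , b , a<b , adja , adjb , cover) ¬f =
  bl-perm {β = β} perm , bl-separable {β = β} sep ,
  suc a , suc b , s≤s a<b , adj-bl {β = β} adja , adj-bl {β = β} adjb , cover′
  where
  cover′ : ∀ i → AdjIndex (bl β) i → i ≡ suc a ⊎ i ≡ suc b
  cover′ zero    adj = contradiction (adj-bl⇒first0 {β = β} adj) ¬f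
  cover′ (suc i) adj = Sum.map (cong suc) (cong suc) (cover i (adj-bl⁻ {β = β} ¬f adj))

-- Having at least two letters, `β` has a bond of its own. Shifted, its two ends are the only
-- adjacent indices of `bl β`. If `β` began with zero, index `zero` would be a third one.
bl-counted⁻ : ∀ {n} {β : Word (2 + n)} → Counted (bl β) → Counted β × ¬ First0 β
bl-counted⁻ {n} {β} (perm , sep , two) = extract (bond-adjacent {σ = β} perm′ (proj₂ bond))
  where
  perm′ : IsPerm β
  perm′ = bl-perm⁻ {β = β} perm
  sep′ : Separable β
  sep′ = bl-separable⁻ {β = β} sep
  bond : ∃[ i ] Bond (2 + n) (at β) i
  bond = separable-bond n (at β) (at-separable {σ = β} perm′ sep′)
  extract : ∀ {i} → ∃[ a ] ∃[ b ] (toℕ a ≡ i × toℕ b ≡ suc i × AdjIndex β a × AdjIndex β b) →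
    Counted β × ¬ First0 β
  extract (a , b , refl , eq , adja , adjb) =
    (perm′ , sep′ , a , b , ≤-reflexive (sym eq) , adja , adjb , cover) , ¬f
    where
    cover′ : ∀ {i} → AdjIndex (bl β) i → i ≡ suc a ⊎ i ≡ suc b
    cover′ = twoAdj-cover {σ = bl β} two (λ { refl → 1+n≢n (sym eq) })
      (adj-bl {β = β} adja) (adj-bl {β = β} adjb)
    cover : ∀ i → AdjIndex β i → i ≡ a ⊎ i ≡ b
    cover i adj = Sum.map Fin.suc-injective Fin.suc-injective (cover′ (adj-bl {β = β} adj))
    ¬f : ¬ First0 β
    ¬f f = case cover′ {zero} (first0⇒adj-bl {β = β} f) of λ { (inj₁ ()) ; (inj₂ ()) }

first0-rc : ∀ {n} {σ : Word (suc n)} → LastMax σ → First0 (rc σ)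
first0-rc {n} {σ} eq = trans (lookup-rc σ zero) (trans (cong opposite eq) (opposite-fromℕ n))

lastMax-rc : ∀ {n} {σ : Word (suc n)} → First0 σ → LastMax (rc σ)
lastMax-rc {n} {σ} eq = trans (lookup-rc σ (fromℕ n))
  (cong opposite (trans (cong (lookup σ) (opposite-fromℕ n)) eq))

first0-rc⁻ : ∀ {n} {σ : Word (suc n)} → First0 (rc σ) → LastMax σ
first0-rc⁻ {σ = σ} = subst LastMax (rc-involutive σ) ∘ lastMax-rc {σ = rc σ}

lastMax-rc⁻ : ∀ {n} {σ : Word (suc n)} → LastMax (rc σ) → First0 σ
lastMax-rc⁻ {σ = σ} = subst First0 (rc-involutive σ) ∘ first0-rc {σ = rc σ}

counted-rc⁻ : ∀ {n} (σ : Word n) → Counted (rc σ) → Counted σ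
counted-rc⁻ σ c = subst Counted (rc-involutive σ) (rc-counted {σ = rc σ} c)

lastMax-bl : ∀ {n} {β : Word (suc n)} → LastMax β → LastMax (bl β)
lastMax-bl {β = β} eq = trans (lookup-bl β _) (cong suc eq)

lastMax-bl⁻ : ∀ {n} {β : Word (suc n)} → LastMax (bl β) → LastMax β
lastMax-bl⁻ {β = β} eq = Fin.suc-injective (trans (sym (lookup-bl β _)) eq)

lastMax-tr : ∀ {n} (β : Word n) → LastMax (tr β)
lastMax-tr β = lastMax-rc {σ = bl (rc β)} refl

first0-tr : ∀ {n} {β : Word (suc n)} → First0 β → First0 (tr β)
first0-tr {β = β} = first0-rc {σ = bl (rc β)} ∘ lastMax-bl {β = rc β} ∘ lastMax-rc {σ = β}

first0-tr⁻ : ∀ {n} {β : Word (suc n)} → First0 (tr β) → First0 β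
first0-tr⁻ {β = β} = lastMax-rc⁻ {σ = β} ∘ lastMax-bl⁻ {β = rc β} ∘ first0-rc⁻ {σ = bl (rc β)}

-- The half turn carries `tr` to `bl` and the condition on the last letter to the one on the first.
tr-counted : ∀ {n} {β : Word (suc n)} → Counted β → ¬ LastMax β → Counted (tr β)
tr-counted {β = β} c ¬l = rc-counted {σ = bl (rc β)}
  (bl-counted {β = rc β} (rc-counted {σ = β} c) (¬l ∘ first0-rc⁻ {σ = β}))

tr-counted⁻ : ∀ {n} {β : Word (2 + n)} → Counted (tr β) → Counted β × ¬ LastMax β
tr-counted⁻ {n} {β} c = counted-rc⁻ β (proj₁ peeled) , proj₂ peeled ∘ first0-rc {σ = β}
  where
  peeled : Counted (rc β) × ¬ First0 (rc β)
  peeled = bl-counted⁻ {β = rc β} (counted-rc⁻ (bl (rc β)) c)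

unsuc : ∀ {m n} (xs : Vec (Fin (suc n)) m) → (∀ i → lookup xs i ≢ zero) → ∃[ ys ] xs ≡ map suc ys
unsuc []           _  = [] , refl
unsuc (zero  ∷ xs) ≢0 = contradiction refl (≢0 zero)
unsuc (suc x ∷ xs) ≢0 with ys , refl ← unsuc xs (≢0 ∘ suc) = x ∷ ys , refl

-- By injectivity zero does not occur again, so all later letters are successors.
first0⇒bl : ∀ {n} {σ : Word (suc n)} → IsPerm σ → First0 σ → ∃[ β ] σ ≡ bl β
first0⇒bl {σ = .zero ∷ xs} perm refl
  with ys , refl ← unsuc xs (λ i eq → case perm (suc i) zero eq of λ ()) = ys , refl

lastMax⇒tr : ∀ {n} {σ : Word (suc n)} → Counted σ → LastMax σ → ∃[ β ] σ ≡ tr β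
lastMax⇒tr {σ = σ} c l
  with β , eq ← first0⇒bl {σ = rc σ} (proj₁ (rc-counted {σ = σ} c)) (first0-rc {σ = σ} l) =
  rc β , trans (sym (rc-involutive σ)) (cong rc (trans eq (cong bl (sym (rc-involutive β)))))

-- Counting by duplicate-free lists

open Equivalence using (to; from)

module _ {A : Set} where

  -- Duplicate-free lists with the same members are permutations of each other. This transfers the
  -- explicit counts to an arbitrary counting function `c`.
  isCount-unique : ∀ {P : A → Set} {k l} → IsCount P k → IsCount P l → k ≡ l
  isCount-unique (xs , uxs , xs⇔ , refl) (ys , uys , ys⇔ , refl) =
    ↭-length (∼bag⇒↭ (unique∧set⇒bag uxs uys (λ {x} → ⇔-trans (xs⇔ x) (⇔-sym (ys⇔ x)))))

  isCount-cong : ∀ {P Q : A → Set} {k} → (∀ x → P x ⇔ Q x) → IsCount P k → IsCount Q k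
  isCount-cong P⇔Q (xs , uxs , xs⇔ , len) = xs , uxs , (λ x → ⇔-trans (xs⇔ x) (P⇔Q x)) , len

  isCount-∅ : ∀ {P : A → Set} → (∀ x → ¬ P x) → IsCount P 0
  isCount-∅ ¬P = [] , [] , (λ x → mk⇔ (λ ()) (λ p → contradiction p (¬P x))) , refl

  isCount-singleton : ∀ {P : A → Set} a → P a → (∀ x → P x → x ≡ a) → IsCount P 1
  isCount-singleton a pa unique = a ∷ [] , [] ∷ [] ,
    (λ x → mk⇔ (λ { (here refl) → pa ; (there ()) }) (λ p → here (unique x p))) , refl

  isCount-⊎ : ∀ {P Q : A → Set} {k l} → (∀ x → P x → ¬ Q x) →
    IsCount P k → IsCount Q l → IsCount (λ x → P x ⊎ Q x) (k + l)
  isCount-⊎ disj (xs , uxs , xs⇔ , refl) (ys , uys , ys⇔ , refl) =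
    xs ++ ys ,
    Unique.++⁺ uxs uys (λ {x} (x∈xs , x∈ys) → disj x (to (xs⇔ x) x∈xs) (to (ys⇔ x) x∈ys)) ,
    (λ x → ⇔-trans ++-∈⇔
      (mk⇔ (Sum.map (to (xs⇔ x)) (to (ys⇔ x))) (Sum.map (from (xs⇔ x)) (from (ys⇔ x))))) ,
    length-++ xs

Image : ∀ {A B : Set} → (A → B) → (A → Set) → B → Set
Image f P y = ∃[ x ] (P x × y ≡ f x)

isCount-image : ∀ {A B : Set} {P : A → Set} {k} (f : A → B) → (∀ {x y} → f x ≡ f y → x ≡ y) →
  IsCount P k → IsCount (Image f P) k
isCount-image f f-inj (xs , uxs , xs⇔ , refl) =
  mapᴸ f xs , Unique.map⁺ f-inj uxs ,
  (λ y → mk⇔ (λ y∈ → let x , x∈ , eq = ∈-map⁻ f y∈ in x , to (xs⇔ x) x∈ , eq)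
             (λ { (x , p , refl) → ∈-map⁺ f (from (xs⇔ x) p) })) ,
  length-map f xs

-- Direct sums, skew sums and their shapes

-- Every counted word has a corner letter, so the corner alone tells the type. Defining the skew
-- type through the complement makes `comp` the bijection between the two.
SumType SkewType : ∀ {n} → Word (suc n) → Set
SumType  σ = Counted σ × SumCorner σ
SkewType σ = Counted σ × SumCorner (comp σ)

counted⇔types : ∀ {n} (σ : Word (suc n)) → (SumType σ ⊎ SkewType σ) ⇔ Counted σ
counted⇔types σ = mk⇔ Sum.[ proj₁ , proj₁ ] (λ c → Sum.map (c ,_) (c ,_) (counted-corner {σ = σ} c))

skewType⇔comp : ∀ {n} (σ : Word (suc n)) → Image comp SumType σ ⇔ SkewType σ
skewType⇔comp σ = mk⇔
  (λ { (τ , (c , corner) , refl) → comp-counted {σ = τ} c , subst SumCorner (sym (comp-involutive τ)) corner })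
  (λ (c , corner) → comp σ , (comp-counted {σ = σ} c , corner) , sym (comp-involutive σ))

comp-injective : ∀ {n} {σ τ : Word n} → comp σ ≡ comp τ → σ ≡ τ
comp-injective {σ = σ} {τ} eq =
  trans (sym (comp-involutive σ)) (trans (cong comp eq) (comp-involutive τ))

skew-¬first0 : ∀ {n} {σ : Word (suc n)} → SkewType σ → ¬ First0 σ
skew-¬first0 {σ = σ} (c , corner) f = corners-exclusive {σ = σ} c (inj₁ f) corner

skew-¬lastMax : ∀ {n} {σ : Word (suc n)} → SkewType σ → ¬ LastMax σ
skew-¬lastMax {σ = σ} (c , corner) l = corners-exclusive {σ = σ} c (inj₂ l) corner

toSkew : ∀ {n} {σ : Word (suc n)} → Counted σ → ¬ First0 σ → ¬ LastMax σ → SkewType σ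
toSkew {σ = σ} c ¬f ¬l with counted-corner {σ = σ} c
... | inj₁ (inj₁ f) = contradiction f ¬f
... | inj₁ (inj₂ l) = contradiction l ¬l
... | inj₂ corner   = c , corner

-- These are 1 ⊕ α, α ⊕ 1 and 1 ⊕ α ⊕ 1. The core is one letter shorter in the first two and two
-- letters shorter in the last, whence the recurrence.
SumShape : ∀ {n} → Word (3 + n) → Set
SumShape σ = Image bl SkewType σ ⊎ (Image tr SkewType σ ⊎ Image (bl ∘ tr) SkewType σ)

length1-¬counted : (σ : Word 1) → ¬ Counted σ
length1-¬counted σ (_ , _ , zero , zero , () , _)

length2-sum : (σ : Word 2) → IsPerm σ → SumCorner σ → σ ≡ zero ∷ suc zero ∷ []
length2-sum (_ ∷ zero ∷ [])           perm (inj₁ refl) = case perm zero (suc zero) refl of λ ()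
length2-sum (_ ∷ suc zero ∷ [])       perm (inj₁ refl) = refl
length2-sum (zero ∷ _ ∷ [])           perm (inj₂ refl) = refl
length2-sum (suc zero ∷ _ ∷ [])       perm (inj₂ refl) = case perm zero (suc zero) refl of λ ()

12-counted : Counted (zero ∷ suc zero ∷ [])
12-counted =
    (λ { zero zero _ → refl ; (suc zero) (suc zero) _ → refl ; zero (suc zero) () ; (suc zero) zero () })
  -- Two positions leave no room for four increasing indices; splitting on the last two already
  -- shows it.
  , ( (λ { (_ , _ , zero , _ , _ , () , _) ; (_ , _ , suc zero , zero , _ , _ , () , _)
        ; (_ , _ , suc zero , suc zero , _ , _ , s≤s () , _) })
    , (λ { (_ , _ , zero , _ , _ , () , _) ; (_ , _ , suc zero , zero , _ , _ , () , _)
        ; (_ , _ , suc zero , suc zero , _ , _ , s≤s () , _) }))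
  , zero , suc zero , s≤s z≤n , (suc zero , refl , refl) , (zero , refl , refl)
  , (λ { zero _ → inj₁ refl ; (suc zero) _ → inj₂ refl })

peel-first : ∀ {n} {σ : Word (3 + n)} → Counted σ → First0 σ →
  ∃[ β ] (Counted β × ¬ First0 β × σ ≡ bl β)
peel-first {σ = σ} c f =
  let β , eq  = first0⇒bl {σ = σ} (proj₁ c) f
      cβ , ¬f = bl-counted⁻ {β = β} (subst Counted eq c)
  in β , cβ , ¬f , eq

peel-last : ∀ {n} {σ : Word (3 + n)} → Counted σ → LastMax σ →
  ∃[ β ] (Counted β × ¬ LastMax β × σ ≡ tr β)
peel-last {σ = σ} c l =
  let β , eq  = lastMax⇒tr {σ = σ} c l
      cβ , ¬l = tr-counted⁻ {β = β} (subst Counted eq c)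
  in β , cβ , ¬l , eq

-- In length two the only direct sum starts with zero. In greater length the core inherits the
-- absence of a first corner, because `tr` would preserve one, and has no last corner by peeling.
peel-last-skew : ∀ {n} {σ : Word (2 + n)} → Counted σ → ¬ First0 σ → LastMax σ → Image tr SkewType σ
peel-last-skew {zero} {σ} c ¬f l =
  contradiction (cong (λ τ → lookup τ zero) (length2-sum σ (proj₁ c) (inj₂ l))) ¬f
peel-last-skew {suc n} {σ} c ¬f l =
  let α , cα , ¬l , eq = peel-last {σ = σ} c l
  in α , toSkew {σ = α} cα (λ f → ¬f (subst First0 (sym eq) (first0-tr {β = α} f))) ¬l , eq

sumType⇔shape : ∀ {n} (σ : Word (3 + n)) → SumShape σ ⇔ SumType σ
sumType⇔shape σ = mk⇔ shape⇒ (λ (c , corner) → ⇒shape c corner)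
  where
  shape⇒ : SumShape σ → SumType σ
  shape⇒ (inj₁ (α , s , refl)) = bl-counted {β = α} (proj₁ s) (skew-¬first0 {σ = α} s) , inj₁ refl
  shape⇒ (inj₂ (inj₁ (α , s , refl))) =
    tr-counted {β = α} (proj₁ s) (skew-¬lastMax {σ = α} s) , inj₂ (lastMax-tr α)
  shape⇒ (inj₂ (inj₂ (α , s , refl))) =
    bl-counted {β = tr α} (tr-counted {β = α} (proj₁ s) (skew-¬lastMax {σ = α} s))
      (skew-¬first0 {σ = α} s ∘ first0-tr⁻ {β = α}) ,
    inj₁ refl
  peeled : ∃[ β ] (Counted β × ¬ First0 β × σ ≡ bl β) → SumShape σ
  peeled (β , c , ¬f , eq) with counted-corner {σ = β} c
  ... | inj₂ skew     = inj₁ (β , (c , skew) , eq)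
  ... | inj₁ (inj₁ f) = contradiction f ¬f
  ... | inj₁ (inj₂ l) = let α , skew , eq′ = peel-last-skew {σ = β} c ¬f l
                        in inj₂ (inj₂ (α , skew , trans eq (cong bl eq′)))
  ⇒shape : Counted σ → SumCorner σ → SumShape σ
  -- The first corner is tested first, so a word with both corners loses its first letter before its
  -- last and ends up in the third shape.
  ⇒shape c corner with lookup σ zero Fin.≟ zero | corner
  ... | yes f | _      = peeled (peel-first {σ = σ} c f)
  ... | no ¬f | inj₁ f = contradiction f ¬f
  ... | no ¬f | inj₂ l = inj₂ (inj₁ (peel-last-skew {σ = σ} c ¬f l))

-- A skew core has no maximal last letter, and `bl` does not create one, whereas both other shapes
-- end in their maximum.
bl-tr-disjoint : ∀ {n} (σ : Word (3 + n)) → Image bl SkewType σ →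
  ¬ (Image tr SkewType σ ⊎ Image (bl ∘ tr) SkewType σ)
bl-tr-disjoint σ (α , s , refl) (inj₁ (β , _ , eq)) =
  skew-¬lastMax {σ = α} s (lastMax-bl⁻ {β = α} (subst LastMax (sym eq) (lastMax-tr β)))
bl-tr-disjoint σ (α , s , refl) (inj₂ (β , _ , eq)) =
  skew-¬lastMax {σ = α} s (subst LastMax (sym (bl-injective {β = α} {tr β} eq)) (lastMax-tr β))

-- Appending a maximum to a skew core cannot create a leading zero.
tr-bltr-disjoint : ∀ {n} (σ : Word (3 + n)) → Image tr SkewType σ → ¬ Image (bl ∘ tr) SkewType σ
tr-bltr-disjoint σ (α , s , refl) (β , _ , eq) =
  skew-¬first0 {σ = α} s (first0-tr⁻ {β = α} (subst First0 (sym eq) refl))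

-- The recurrence

-- The Pell numbers 0, 1, 2, 5, 12, with index `n` standing for length `suc n`. The nesting of the
-- sum follows that of `SumShape`.
sumCount : ℕ → ℕ
sumCount 0             = 0
sumCount 1             = 1
sumCount (suc (suc n)) = sumCount (suc n) + (sumCount (suc n) + sumCount n)

isCount-skew : ∀ {n k} → IsCount (SumType {n}) k → IsCount (SkewType {n}) k
isCount-skew = isCount-cong skewType⇔comp ∘ isCount-image comp comp-injective

isCount-sum-step : ∀ {n k l} → IsCount (SkewType {suc n}) k → IsCount (SkewType {n}) l →
  IsCount (SumType {2 + n}) (k + (k + l))
isCount-sum-step skew₁ skew₀ = isCount-cong sumType⇔shape
  (isCount-⊎ bl-tr-disjoint (isCount-image bl bl-injective skew₁)
    (isCount-⊎ tr-bltr-disjoint (isCount-image tr tr-injective skew₁)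
      (isCount-image (bl ∘ tr) (tr-injective ∘ bl-injective) skew₀)))

isCount-sum : ∀ n → IsCount (SumType {n}) (sumCount n)
isCount-sum 0 = isCount-∅ λ σ → length1-¬counted σ ∘ proj₁
isCount-sum 1 = isCount-singleton (zero ∷ suc zero ∷ []) (12-counted , inj₁ refl)
  λ σ (c , corner) → length2-sum σ (proj₁ c) corner
isCount-sum (suc (suc n)) =
  isCount-sum-step (isCount-skew (isCount-sum (suc n))) (isCount-skew (isCount-sum n))

isCount-counted : ∀ n → IsCount (Counted {suc n}) (sumCount n + sumCount n)
isCount-counted n = isCount-cong counted⇔types
  (isCount-⊎ (λ σ (c , p) (_ , q) → corners-exclusive {σ = σ} c p q) (isCount-sum n)
    (isCount-skew (isCount-sum n)))

-- The generating function

-- Stated for a general index function `f`, since each step of the induction shifts it by one. It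
-- removes the tail of the convolution.
sum-applyUpTo-zero : ∀ (h : ℕ → ℤ) (f : ℕ → ℕ) n → (∀ k → h (f k) ≡ pos 0) →
  foldr _+ℤ_ (pos 0) (mapᴸ h (applyUpTo f n)) ≡ pos 0
sum-applyUpTo-zero h f zero    _   = refl
sum-applyUpTo-zero h f (suc n) h≡0 rewrite h≡0 0 | sum-applyUpTo-zero h (f ∘ suc) n (h≡0 ∘ suc) = refl

denom-series : (c : ℕ → ℕ) → c 0 ≡ 0 → c 1 ≡ 0 → c 2 ≡ 2 →
  (∀ n → c (3 + n) ≡ 2 * c (2 + n) + c (1 + n)) → ∀ n → (denom ·ₛ series c) n ≡ numer n
denom-series c c0 c1 c2 rec 0 rewrite c0 = refl
denom-series c c0 c1 c2 rec 1 rewrite c0 | c1 = refl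
denom-series c c0 c1 c2 rec 2 rewrite c0 | c1 | c2 = refl
denom-series c c0 c1 c2 rec (suc (suc (suc n)))
  -- Of the `4 + n` terms the last `suc n` vanish, as `denom` is zero from index three on.
  rewrite sum-applyUpTo-zero (λ k → denom k *ℤ series c (3 + n ∸ k)) (λ k → 3 + k) (suc n) (λ _ → refl) =
  trans (cong (λ x → pos 1 *ℤ x +ℤ (- pos 2 *ℤ a +ℤ (- pos 1 *ℤ b +ℤ pos 0))) pos-rec)
    (solve 2 (λ a b → con (pos 1) :* (con (pos 2) :* a :+ b) :+
        (con (- pos 2) :* a :+ (con (- pos 1) :* b :+ con (pos 0))) := con (pos 0)) refl a b)
  where
  open ℤSolver.+-*-Solver
  a = pos (c (2 + n))
  b = pos (c (1 + n))
  pos-rec : pos (c (3 + n)) ≡ pos 2 *ℤ a +ℤ b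
  pos-rec = trans (cong pos (rec n))
    (trans (ℤ.pos-+ (2 * c (2 + n)) (c (1 + n))) (cong (_+ℤ b) (ℤ.pos-* 2 (c (2 + n)))))

double-pell : ∀ a b → (a + (a + b)) + (a + (a + b)) ≡ 2 * (a + a) + (b + b)
double-pell = solve-∀

theorem9 : (c : ℕ → ℕ) → (∀ n → IsCount (Counted {n}) (c n)) →
    (c 0 ≡ 0 × c 1 ≡ 0 × c 2 ≡ 2 ×
    (∀ n → c (3 + n) ≡ 2 * c (2 + n) + c (1 + n))) ×
    (∀ n → (denom ·ₛ series c) n ≡ numer n)
theorem9 c count = (c0 , c≡ 0 , c≡ 1 , rec) , denom-series c c0 (c≡ 0) (c≡ 1) rec
  where
  c0 : c 0 ≡ 0
  c0 = isCount-unique (count 0) (isCount-∅ λ { σ (_ , _ , () , _) })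
  c≡ : ∀ n → c (suc n) ≡ sumCount n + sumCount n
  c≡ n = isCount-unique (count (suc n)) (isCount-counted n)
  rec : ∀ n → c (3 + n) ≡ 2 * c (2 + n) + c (1 + n)
  rec n = begin
    c (3 + n)                      ≡⟨ c≡ (2 + n) ⟩
    s₂ + s₂                        ≡⟨ double-pell s₁ s₀ ⟩
    2 * (s₁ + s₁) + (s₀ + s₀)      ≡⟨ cong₂ (λ x y → 2 * x + y) (c≡ (1 + n)) (c≡ n) ⟨
    2 * c (2 + n) + c (1 + n)      ∎
    where
    open ≡-Reasoning
    s₀ = sumCount n
    s₁ = sumCount (1 + n)
    s₂ = sumCount (2 + n)
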